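{- Let $d > 4$ be an integer and let $K$ be the field of fractions of a complete discrete valuation ring $\mathcal{O}$. In the coefficient-choosing game of degree $d$ over $K$, whichever player makes the last move has a winning strategy.
   Context: The coefficient-choosing game of degree $d$ over $K$: Nora and Wanda alternately choose coefficients of $f(x) = a_d x^d + \cdots + a_0$; on each move the current player picks a not-yet-chosen coefficient and assigns it a value in $K$, subject to $a_d \neq 0$, $a_0 \neq 0$. After all $d+1$ coefficients are chosen, Wanda wins if $f$ has a root in $K$, and Nora wins otherwise. Who moves first is fixed in advance, which determines who makes the last move. -}

module Defs where

open import Algebra.Bundles using (CommutativeRing)
import Algebra.Definitions as AlgebraDefinitions
import Algebra.Definitions.RawMagma as RawMagmaDefinitions
import Algebra.Morphism.Structures as Morphisms
import Algebra.Properties.Monoid.Sum as Sum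
import Algebra.Properties.Semiring.Exp as Exp
open import Data.Fin.Base using (Fin; toℕ)
open import Data.Maybe.Base using (Maybe; just; nothing; fromMaybe)
open import Data.Nat.Base using (ℕ; zero; suc; _<_) renaming (_≤_ to _≤ℕ_)
open import Data.Product.Base using (_×_; ∃-syntax; Σ-syntax)
open import Data.Sum.Base using (_⊎_)
open import Data.Unit.Polymorphic.Base using (⊤)
open import Data.Vec.Base using (Vec; lookup; replicate; _[_]≔_)
open import Function.Bundles using (_⇔_)
open import Level using (Level; _⊔_) renaming (suc to lsuc)
open import Relation.Binary.PropositionalEquality.Core using (_≡_; _≢_)
open import Relation.Nullary.Negation.Core using (¬_)
open import Relation.Unary using (Pred; _∈_)

------------------------------------------------------------------------
-- Commutative algebra

module _ {c ℓ : Level} (R : CommutativeRing c ℓ) where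
  open CommutativeRing R
  open AlgebraDefinitions _≈_ using (Invertible)
  open RawMagmaDefinitions *-rawMagma using (_∣_)

  IsUnit : Pred Carrier (c ⊔ ℓ)
  IsUnit x = Invertible 1# _*_ x

  NonUnit : Pred Carrier (c ⊔ ℓ)
  NonUnit x = ¬ IsUnit x

  record IsField : Set (c ⊔ ℓ) where
    field
      1≉0     : 1# ≉ 0#
      inverse : ∀ x → x ≉ 0# → IsUnit x

  record IsIntegralDomain : Set (c ⊔ ℓ) where
    field
      1≉0            : 1# ≉ 0#
      noZeroDivisors : ∀ x y → x * y ≈ 0# → x ≈ 0# ⊎ y ≈ 0#

  -- Closure under negation follows from *-closed.
  record IsIdeal {p} (I : Pred Carrier p) : Set (c ⊔ ℓ ⊔ p) where
    field
      resp     : ∀ {x y} → x ≈ y → x ∈ I → y ∈ I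
      0∈       : 0# ∈ I
      +-closed : ∀ {x y} → x ∈ I → y ∈ I → x + y ∈ I
      *-closed : ∀ r {x} → x ∈ I → r * x ∈ I

  IsPrincipal : ∀ {p} → Pred Carrier p → Set (c ⊔ ℓ ⊔ p)
  IsPrincipal I = ∃[ g ] (∀ x → x ∈ I ⇔ g ∣ x)

  -- The ideal generated by the products x * y with x ∈ I and y ∈ J.
  data IdealProduct {p q} (I : Pred Carrier p) (J : Pred Carrier q) :
                    Pred Carrier (c ⊔ ℓ ⊔ p ⊔ q) where
    none : ∀ {z} → z ≈ 0# → IdealProduct I J z
    add  : ∀ {x y z w} → x ∈ I → y ∈ J → IdealProduct I J z →
           w ≈ x * y + z → IdealProduct I J w

  IdealPower : Pred Carrier (c ⊔ ℓ) → ℕ → Pred Carrier (c ⊔ ℓ)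
  IdealPower I zero    = λ _ → ⊤
  IdealPower I (suc n) = IdealProduct I (IdealPower I n)

  module _ (I : Pred Carrier (c ⊔ ℓ)) where

    IsCauchy : (ℕ → Carrier) → Set (c ⊔ ℓ)
    IsCauchy s = ∀ k → ∃[ N ] (∀ m n → N ≤ℕ m → N ≤ℕ n →
                               s m - s n ∈ IdealPower I k)

    ConvergesTo : (ℕ → Carrier) → Carrier → Set (c ⊔ ℓ)
    ConvergesTo s a = ∀ k → ∃[ N ] (∀ n → N ≤ℕ n → s n - a ∈ IdealPower I k)

    record IsAdicallyComplete : Set (c ⊔ ℓ) where
      field
        separated : ∀ x → (∀ k → x ∈ IdealPower I k) → x ≈ 0#
        converges : ∀ s → IsCauchy s → ∃[ a ] ConvergesTo s a

  -- A local principal ideal domain that is not a field.  Under excluded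
  -- middle an ideal at any level is equivalent to one at level c ⊔ ℓ, so
  -- quantifying over that level only loses nothing.
  record IsDVR : Set (lsuc (c ⊔ ℓ)) where
    field
      isIntegralDomain : IsIntegralDomain
      principal        : (I : Pred Carrier (c ⊔ ℓ)) → IsIdeal I → IsPrincipal I
      local            : IsIdeal NonUnit
      notField         : ¬ IsField

  record IsCompleteDVR : Set (lsuc (c ⊔ ℓ)) where
    field
      isDVR    : IsDVR
      complete : IsAdicallyComplete NonUnit

module _ {c ℓ k ℓk : Level}
         (O : CommutativeRing c ℓ) (K : CommutativeRing k ℓk) where
  private
    module O = CommutativeRing O
    module K = CommutativeRing K
  open Morphisms.RingMorphisms O.rawRing K.rawRing using (IsRingMonomorphism)

  record IsFieldOfFractions (ι : O.Carrier → K.Carrier) :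
                            Set (c ⊔ ℓ ⊔ k ⊔ ℓk) where
    field
      isField            : IsField K
      isRingMonomorphism : IsRingMonomorphism ι
      fraction           : ∀ x → ∃[ a ] ∃[ b ]
                             (b O.≉ O.0# × x K.* ι b K.≈ ι a)

------------------------------------------------------------------------
-- The coefficient-choosing game

data Player : Set where
  nora wanda : Player

opponent : Player → Player
opponent nora  = wanda
opponent wanda = nora

-- The player who moves after n moves have been made.
toMove : (first : Player) → ℕ → Player
toMove first zero    = first
toMove first (suc n) = opponent (toMove first n)

-- A game of degree d has d + 1 moves, the last one made after d moves.
lastMover : (first : Player) (d : ℕ) → Player
lastMover first d = toMove first d

module Game {k ℓk : Level} (K : CommutativeRing k ℓk) (d : ℕ) where
  open CommutativeRing K
  open Sum +-monoid using (sum)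
  open Exp semiring using (_^_)

  -- Entry i is the coefficient of x ^ i, or nothing if not yet chosen.
  Position : Set k
  Position = Vec (Maybe Carrier) (suc d)

  emptyPosition : Position
  emptyPosition = replicate (suc d) nothing

  record LegalMove (pos : Position) : Set (k ⊔ ℓk) where
    field
      index    : Fin (suc d)
      value    : Carrier
      unchosen : lookup pos index ≡ nothing
      nonzero  : toℕ index ≡ 0 ⊎ toℕ index ≡ d → value ≉ 0#

  makeMove : (pos : Position) → LegalMove pos → Position
  makeMove pos m = pos [ index ]≔ just value
    where open LegalMove m

  -- Histories of n legal moves, indexed by the position they lead to.
  data Play : ℕ → Position → Set (k ⊔ ℓk) where
    start : Play 0 emptyPosition
    _▷_   : ∀ {n pos} → Play n pos → (m : LegalMove pos) →
            Play (suc n) (makeMove pos m)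

  -- The default 0# is irrelevant for outcomes: these are only evaluated
  -- after d + 1 moves, when every coefficient has been chosen.
  coefficient : Position → Fin (suc d) → Carrier
  coefficient pos i = fromMaybe 0# (lookup pos i)

  evaluate : Position → Carrier → Carrier
  evaluate pos x = sum (λ i → coefficient pos i * x ^ toℕ i)

  HasRoot : Position → Set (k ⊔ ℓk)
  HasRoot pos = ∃[ x ] evaluate pos x ≈ 0#

  Wins : Player → Position → Set (k ⊔ ℓk)
  Wins wanda pos = HasRoot pos
  Wins nora  pos = ¬ HasRoot pos

  module _ (first P : Player) where

    Strategy : Set (k ⊔ ℓk)
    Strategy = ∀ {n pos} → Play n pos → n < suc d → toMove first n ≡ P →
               LegalMove pos

    -- Plays in which every move of P is the one prescribed by σ.
    data Follows (σ : Strategy) : ∀ {n pos} → Play n pos → Set (k ⊔ ℓk) where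
      start    : Follows σ start
      own      : ∀ {n pos} {h : Play n pos} → Follows σ h →
                 (n<1+d : n < suc d) (turn : toMove first n ≡ P) →
                 Follows σ (h ▷ σ h n<1+d turn)
      opposing : ∀ {n pos} {h : Play n pos} → Follows σ h →
                 toMove first n ≢ P → (m : LegalMove pos) →
                 Follows σ (h ▷ m)

    IsWinning : Strategy → Set (k ⊔ ℓk)
    IsWinning σ = ∀ {pos} {h : Play (suc d) pos} → Follows σ h → Wins P pos

    HasWinningStrategy : Set (k ⊔ ℓk)
    HasWinningStrategy = Σ[ σ ∈ Strategy ] IsWinning σ

{-# OPTIONS --safe #-}
-- Completeness of O is used only through ⋂ 𝔪ᵏ = 0, which makes every nonzero
-- element of O a unit times a power of a uniformizer π.
--
-- If Wanda moves last, the position has a nonzero end coefficient, so its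
-- polynomial g (with 0 for the unchosen coefficient aᵢ) does not vanish at some
-- x = π^{±m} with m large, and aᵢ = - g(x) / xⁱ makes x a root.
--
-- If Nora moves last, she first makes sure that a₁ and a_{d-1} get chosen.  She
-- then picks aᵢ of very negative valuation -N (after clearing denominators).
-- The Newton polygon has the vertices 0, i and d, and it has no integral slope
-- when i ∤ N + v(a₀) and d - i ∤ N + v(a_d).  As i ≠ 1, d - i ≠ 1 and i, d - i
-- are not both 2, such N exist.  Roots x ∉ O are treated as the roots y = 1/x ∈ O
-- of the reversed polynomial, whose exponents are d - j.

module Submission where

open import Defs
open import Algebra.Bundles using (CommutativeRing)
import Algebra.Morphism.Structures as Morphisms
import Algebra.Properties.CommutativeSemigroup as CommutativeSemigroupProperties
import Algebra.Properties.CommutativeSemigroup.Divisibility as CommutativeSemigroupDivisibility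
import Algebra.Properties.CommutativeSemiring.Exp as ExpProperties
import Algebra.Properties.Group as GroupProperties
import Algebra.Properties.Ring as RingProperties
import Algebra.Properties.Semiring.Divisibility as DivisibilityProperties
import Algebra.Properties.Semiring.Sum as SumProperties
open import Axiom.ExcludedMiddle using (ExcludedMiddle)
open import Data.Fin.Base using (Fin; zero; suc; toℕ; fromℕ; fromℕ<; punchIn)
import Data.Fin.Properties as Finₚ
open import Data.Maybe.Base using (Maybe; just; nothing; fromMaybe)
open import Data.Nat.Base as ℕ using (ℕ; zero; suc; z≤n; s≤s; _≤_; _<_; _>_)
import Data.Nat.Divisibility as ℕ∣
import Data.Nat.Properties as ℕₚ
open import Data.Product.Base using (_×_; ∃-syntax; Σ-syntax; _,_; proj₁; proj₂)
open import Data.Sum.Base using (_⊎_; inj₁; inj₂)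
open import Data.Unit.Polymorphic.Base using (tt)
open import Data.Vec.Base using (Vec; []; _∷_; lookup; replicate; _[_]≔_)
import Data.Vec.Properties as Vecₚ
open import Function.Base using (_∘_; const)
open import Function.Bundles using (Equivalence)
open import Level using (_⊔_)
open import Relation.Binary.Definitions using (tri<; tri≈; tri>)
open import Relation.Binary.PropositionalEquality as ≡ using (_≡_; _≢_)
import Relation.Binary.Reasoning.Setoid as SetoidReasoning
open import Relation.Nullary using (¬_; Dec; yes; no; contradiction)

-- Divisibility and finite sums in commutative rings and domains.

module RingLemmas {c ℓ} (R : CommutativeRing c ℓ) where
  open CommutativeRing R public hiding (zero)
  open ExpProperties commutativeSemiring public
    using (_^_; ^-congˡ; ^-homo-*; ^-distrib-*)
  open SumProperties semiring public
    using (sum; sum-cong-≋; sum-remove; *-distribʳ-sum)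
  open DivisibilityProperties semiring public
    using (_∣_; _,_; _∣0; 1∣_; ∣ʳ-refl; ∣ʳ-trans; ∣ʳ-respʳ-≈; ∣ʳ-respˡ-≈;
           x∣ʳy⇒x∣ʳzy)
  open CommutativeSemigroupDivisibility *-commutativeSemigroup public
    using (∙-cong-∣; x∣xy)
  open CommutativeSemigroupProperties *-commutativeSemigroup public
    using (interchange; x∙yz≈y∙xz; xy∙z≈xz∙y)
  open GroupProperties +-group public using (x∙y⁻¹≈ε⇒x≈y; x≈y⇒x∙y⁻¹≈ε)
  open RingProperties ring public
    using (x[y-z]≈xy-xz; -‿distribˡ-*)

  x∣y⇒x∣yz : ∀ {x y} z → x ∣ y → x ∣ y * z
  x∣y⇒x∣yz z x∣y = ∣ʳ-trans x∣y (x∣xy _ z)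

  ∣-+ : ∀ {p x y} → p ∣ x → p ∣ y → p ∣ x + y
  ∣-+ (q , qp≈x) (r , rp≈y) = q + r , trans (distribʳ _ q r) (+-cong qp≈x rp≈y)

  ∣-neg : ∀ {p x} → p ∣ x → p ∣ - x
  ∣-neg (q , qp≈x) = - q , trans (sym (-‿distribˡ-* q _)) (-‿cong qp≈x)

  ∣-sum : ∀ {p n} (t : Fin n → Carrier) → (∀ j → p ∣ t j) → p ∣ sum t
  ∣-sum {n = zero}  t p∣t = _ ∣0
  ∣-sum {n = suc n} t p∣t = ∣-+ (p∣t zero) (∣-sum (t ∘ suc) (p∣t ∘ suc))

  x+y≈0⇒x≈-y : ∀ {x y} → x + y ≈ 0# → x ≈ - y
  x+y≈0⇒x≈-y {x} {y} = GroupProperties.inverseˡ-unique +-group x y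

  -- If the sum vanished, `t m` would be minus the sum of the other terms, hence divisible by `p`.
  -- With `p` a power of `π` this is the ultrametric principle that a unique term of least valuation
  -- cannot be cancelled.
  dominantTerm⇒sum≉0 : ∀ {p n} (t : Fin (suc n) → Carrier) m → ¬ p ∣ t m →
                       (∀ j → j ≢ m → p ∣ t j) → sum t ≉ 0#
  dominantTerm⇒sum≉0 t m p∤tₘ p∣tⱼ Σt≈0 = p∤tₘ
    (∣ʳ-respʳ-≈ (sym (x+y≈0⇒x≈-y (trans (sym (sum-remove t)) Σt≈0)))
      (∣-neg (∣-sum _ λ j → p∣tⱼ (punchIn m j) (Finₚ.punchInᵢ≢i m j))))

  ^-mono-∣ : ∀ p {m n} → m ≤ n → p ^ m ∣ p ^ n
  ^-mono-∣ p z≤n       = 1∣ _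
  ^-mono-∣ p (s≤s m≤n) = ∙-cong-∣ ∣ʳ-refl (^-mono-∣ p m≤n)

  x∣x^n : ∀ x {n} → 0 < n → x ∣ x ^ n
  x∣x^n x {suc n} _ = x∣xy x (x ^ n)

module DomainLemmas {c ℓ} (R : CommutativeRing c ℓ)
                    (domain : IsIntegralDomain R) where
  open RingLemmas R
  open IsIntegralDomain domain

  *-cancelˡ : ∀ {x y z} → x ≉ 0# → x * y ≈ x * z → y ≈ z
  *-cancelˡ {x} {y} {z} x≉0 xy≈xz
    with noZeroDivisors x (y - z)
           (trans (x[y-z]≈xy-xz x y z) (x≈y⇒x∙y⁻¹≈ε xy≈xz))
  ... | inj₁ x≈0   = contradiction x≈0 x≉0
  ... | inj₂ y-z≈0 = x∙y⁻¹≈ε⇒x≈y y z y-z≈0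

  *-cancelʳ : ∀ {x y z} → x ≉ 0# → y * x ≈ z * x → y ≈ z
  *-cancelʳ x≉0 yx≈zx =
    *-cancelˡ x≉0 (trans (*-comm _ _) (trans yx≈zx (*-comm _ _)))

  x≉0∧y≉0⇒xy≉0 : ∀ {x y} → x ≉ 0# → y ≉ 0# → x * y ≉ 0#
  x≉0∧y≉0⇒xy≉0 x≉0 y≉0 xy≈0 with noZeroDivisors _ _ xy≈0
  ... | inj₁ x≈0 = x≉0 x≈0
  ... | inj₂ y≈0 = y≉0 y≈0

  x≉0⇒x^n≉0 : ∀ {x} n → x ≉ 0# → x ^ n ≉ 0#
  x≉0⇒x^n≉0 zero    x≉0 = 1≉0
  x≉0⇒x^n≉0 (suc n) x≉0 = x≉0∧y≉0⇒xy≉0 x≉0 (x≉0⇒x^n≉0 n x≉0)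

-- The valuation of a complete discrete valuation ring.

module Valuation (em : ∀ a → ExcludedMiddle a)
                 {c ℓ} (O : CommutativeRing c ℓ) (cdvr : IsCompleteDVR O) where
  open RingLemmas O
  open IsCompleteDVR cdvr
  open IsDVR isDVR
  open IsAdicallyComplete complete
  open DomainLemmas O isIntegralDomain public
  open IsIntegralDomain isIntegralDomain public using (1≉0)

  π : Carrier
  π = proj₁ (principal (NonUnit O) local)

  private
    NonUnit⇔π∣ = proj₂ (principal (NonUnit O) local)

  ∣1⇒IsUnit : ∀ {x} → x ∣ 1# → IsUnit O x
  ∣1⇒IsUnit (q , qx≈1) = q , qx≈1 , trans (*-comm _ q) qx≈1

  IsUnit⇒∣1 : ∀ {x} → IsUnit O x → x ∣ 1#
  IsUnit⇒∣1 (q , qx≈1 , _) = q , qx≈1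

  π-nonUnit : NonUnit O π
  π-nonUnit = Equivalence.from (NonUnit⇔π∣ π) ∣ʳ-refl

  π∤1 : ¬ π ∣ 1#
  π∤1 = π-nonUnit ∘ ∣1⇒IsUnit

  -- By excluded middle, an element that is not a unit lies in the maximal ideal, which `π`
  -- generates.
  π∤⇒∣1 : ∀ {x} → ¬ π ∣ x → x ∣ 1#
  π∤⇒∣1 {x} π∤x with em _ {IsUnit O x}
  ... | yes unit    = IsUnit⇒∣1 unit
  ... | no  nonUnit = contradiction (Equivalence.to (NonUnit⇔π∣ x) nonUnit) π∤x

  -- If `π` were 0, it would divide only 0, every nonzero element would be a unit, and `O` would be
  -- a field.
  π≉0 : π ≉ 0#
  π≉0 π≈0 = notField record
    { 1≉0     = 1≉0
    ; inverse = λ x x≉0 → ∣1⇒IsUnit (π∤⇒∣1 λ (q , qπ≈x) →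
        x≉0 (trans (sym qπ≈x) (trans (*-congˡ π≈0) (zeroʳ q))))
    }

  π^n≉0 : ∀ n → π ^ n ≉ 0#
  π^n≉0 n = x≉0⇒x^n≉0 n π≉0

  π^k∣⇒∈IdealPower : ∀ k {x} → π ^ k ∣ x → IdealPower O (NonUnit O) k x
  π^k∣⇒∈IdealPower zero    _             = tt
  π^k∣⇒∈IdealPower (suc k) (q , qππᵏ≈x) =
    add π-nonUnit (π^k∣⇒∈IdealPower k (q , refl)) (none refl)
      (trans (trans (sym qππᵏ≈x) (x∙yz≈y∙xz q π (π ^ k))) (sym (+-identityʳ _)))

  -- The relation `v(x) = n`. As a relation rather than a function it needs no conventional value at
  -- 0, which has no valuation.
  record Val (x : Carrier) (n : ℕ) : Set (c ⊔ ℓ) where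
    constructor val
    field
      {unit} : Carrier
      isUnit : unit ∣ 1#
      factor : unit * π ^ n ≈ x

  Val-π^ : ∀ n → Val (π ^ n) n
  Val-π^ n = val ∣ʳ-refl (*-identityˡ _)

  Val-* : ∀ {x y m n} → Val x m → Val y n → Val (x * y) (m ℕ.+ n)
  Val-* {m = m} {n} (val u∣1 uπᵐ≈x) (val w∣1 wπⁿ≈y) = val
    (∣ʳ-respʳ-≈ (*-identityˡ 1#) (∙-cong-∣ u∣1 w∣1))
    (trans (*-congˡ (^-homo-* π m n))
      (trans (interchange _ _ _ _) (*-cong uπᵐ≈x wπⁿ≈y)))

  Val-^ : ∀ {x m} e → Val x m → Val (x ^ e) (e ℕ.* m)
  Val-^ zero    _ = Val-π^ 0
  Val-^ (suc e) v = Val-* v (Val-^ e v)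

  Val-resp-≈ : ∀ {x y n} → x ≈ y → Val x n → Val y n
  Val-resp-≈ x≈y (val u∣1 uπⁿ≈x) = val u∣1 (trans uπⁿ≈x x≈y)

  Val⇒π^∣ : ∀ {x m n} → m ≤ n → Val x n → π ^ m ∣ x
  Val⇒π^∣ m≤n (val _ uπⁿ≈x) = ∣ʳ-trans (^-mono-∣ π m≤n) (_ , uπⁿ≈x)

  Val⇒∣π^ : ∀ {x n} → Val x n → x ∣ π ^ n
  Val⇒∣π^ (val u∣1 uπⁿ≈x) =
    ∣ʳ-respˡ-≈ uπⁿ≈x (∣ʳ-respʳ-≈ (*-identityˡ _) (∙-cong-∣ u∣1 ∣ʳ-refl))

  Val⇒π^∤ : ∀ {x n} → Val x n → ¬ π ^ suc n ∣ x
  Val⇒π^∤ {n = n} (val u∣1 uπⁿ≈x) (q , qππⁿ≈x) = π∤1 (∣ʳ-trans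
    (q , *-cancelʳ (π^n≉0 n)
           (trans (*-assoc q π _) (trans qππⁿ≈x (sym uπⁿ≈x))))
    u∣1)

  -- Separatedness yields a power of `π` that does not divide `x`. Descending from it reaches the
  -- largest power that does; its cofactor is not divisible by `π` and so is a unit.
  valuation : ∀ {x} → x ≉ 0# → ∃[ n ] Val x n
  valuation {x} x≉0 with em _ {∃[ k ] ¬ π ^ k ∣ x}
  ... | no all∣ = contradiction (separated x λ k → π^k∣⇒∈IdealPower k (π^∣x k)) x≉0
    where
    π^∣x : ∀ k → π ^ k ∣ x
    π^∣x k with em _ {π ^ k ∣ x}
    ... | yes π^k∣x = π^k∣x
    ... | no  π^k∤x = contradiction (k , π^k∤x) all∣
  ... | yes (k , π^k∤x) = descend k π^k∤x
    where
    descend : ∀ k → ¬ π ^ k ∣ x → ∃[ n ] Val x n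
    descend zero    1∤x = contradiction (1∣ x) 1∤x
    descend (suc k) π^1+k∤x with em _ {π ^ k ∣ x}
    ... | no  π^k∤x        = descend k π^k∤x
    ... | yes (u , uπᵏ≈x) = k , val
      (π∤⇒∣1 λ π∣u → π^1+k∤x (∣ʳ-respʳ-≈ uπᵏ≈x (∙-cong-∣ π∣u ∣ʳ-refl)))
      uπᵏ≈x

  ∣-total : ∀ x y → x ∣ y ⊎ y ∣ x
  ∣-total x y with em _ {x ≈ 0#} | em _ {y ≈ 0#}
  ... | yes x≈0 | _       = inj₂ (∣ʳ-respʳ-≈ (sym x≈0) (y ∣0))
  ... | no  _   | yes y≈0 = inj₁ (∣ʳ-respʳ-≈ (sym y≈0) (x ∣0))
  ... | no  x≉0 | no  y≉0 with valuation x≉0 | valuation y≉0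
  ...   | m , vx | n , vy with ℕₚ.≤-total m n
  ...     | inj₁ m≤n = inj₁ (∣ʳ-trans (Val⇒∣π^ vx) (Val⇒π^∣ m≤n vy))
  ...     | inj₂ n≤m = inj₂ (∣ʳ-trans (Val⇒∣π^ vy) (Val⇒π^∣ n≤m vx))

  -- Sums whose term of least valuation is unique.

  module _ {n} (a : Fin (suc n) → Carrier) (e : Fin (suc n) → ℕ)
           (z : Fin (suc n)) (eᶻ≡0 : e z ≡ 0) (0<e : ∀ j → j ≢ z → 0 < e j) where

    private
      -- The exponents `e` are kept general so that one argument serves a polynomial (`e j = j`) and
      -- its reversal (`e j = d - j`); `z` is the index of the constant term.
      term : Carrier → Fin (suc n) → Carrier
      term y j = a j * y ^ e j

      term-z : ∀ y → a z ≈ term y z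
      term-z y = trans (sym (*-identityʳ _)) (*-congˡ (reflexive (≡.cong (y ^_) (≡.sym eᶻ≡0))))

    -- At `π ^ suc B` every term other than the constant one has valuation above `B`, the valuation
    -- of the constant term.
    nonRoot : ∀ {B} → Val (a z) B → sum (term (π ^ suc B)) ≉ 0#
    nonRoot {B} v = dominantTerm⇒sum≉0 (term (π ^ suc B)) z
      (Val⇒π^∤ (Val-resp-≈ (term-z _) v))
      (λ j j≢z → x∣ʳy⇒x∣ʳzy (a j) (x∣x^n (π ^ suc B) (0<e j j≢z)))

    -- The polynomial after Nora's last move, multiplied by `π ^ N` and a common denominator: her
    -- coefficient becomes 1, all others become multiples of `π ^ N`, and `B` is the valuation of
    -- the constant term before the factor `π ^ N`. The constant term may itself be hers, whence the
    -- condition `z ≢ i`.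
    module _ (i : Fin (suc n)) (N B : ℕ) (aᵢ≈1 : a i ≈ 1#)
             (π^N∣aⱼ : ∀ j → j ≢ i → π ^ N ∣ a j)
             (Val-aᶻ : z ≢ i → Val (a z) (N ℕ.+ B))
             (eᵢB<N : e i ℕ.* B < N) (eᵢ∤N+B : ¬ e i ℕ∣.∣ N ℕ.+ B) where

      private
        term-i : ∀ y → y ^ e i ≈ term y i
        term-i y = trans (sym (*-identityˡ _)) (*-congʳ (sym aᵢ≈1))

      private
        -- The coefficient contributes `π ^ N`, and the power of `y`, whose exponent is positive,
        -- contributes `π ^ suc B`.
        π^N+1+B∣term : ∀ {y} → π ^ suc B ∣ y → ∀ j → j ≢ i → j ≢ z →
                       π ^ suc (N ℕ.+ B) ∣ term y j
        π^N+1+B∣term {y} π^1+B∣y j j≢i j≢z = ∣ʳ-respˡ-≈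
          (trans (sym (^-homo-* π N (suc B))) (reflexive (≡.cong (π ^_) (ℕₚ.+-suc N B))))
          (∙-cong-∣ (π^N∣aⱼ j j≢i) (∣ʳ-trans π^1+B∣y (x∣x^n y (0<e j j≢z))))

        zDominates : z ≢ i → ∀ {y} → π ^ suc B ∣ y → π ^ suc (N ℕ.+ B) ∣ y ^ e i →
                     sum (term y) ≉ 0#
        zDominates z≢i {y} π^1+B∣y π^∣yᵉ = dominantTerm⇒sum≉0 (term y) z
          (Val⇒π^∤ (Val-resp-≈ (term-z y) (Val-aᶻ z≢i))) other
          where
          other : ∀ j → j ≢ z → π ^ suc (N ℕ.+ B) ∣ term y j
          other j j≢z with j Finₚ.≟ i
          ... | yes ≡.refl = x∣ʳy⇒x∣ʳzy (a i) π^∣yᵉ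
          ... | no  j≢i    = π^N+1+B∣term π^1+B∣y j j≢i j≢z

        iDominates : ∀ {y m} → Val (y ^ e i) m → (∀ j → j ≢ i → π ^ suc m ∣ term y j) →
                     sum (term y) ≉ 0#
        iDominates {y} v = dominantTerm⇒sum≉0 (term y) i (Val⇒π^∤ (Val-resp-≈ (term-i y) v))

      -- Term i or term z is the unique one of least valuation: a tie between
      -- them would mean e i * v(y) = N + B.
      noRoot : ∀ y → sum (term y) ≉ 0#
      noRoot y with z Finₚ.≟ i
      -- Here `e i` is 0, so term `i` has valuation 0, while `N` is positive.
      ... | yes ≡.refl = iDominates {m = 0}
        (Val-resp-≈ (reflexive (≡.cong (y ^_) (≡.sym eᶻ≡0))) (Val-π^ 0))
        λ j j≢i → x∣y⇒x∣yz _ (∣ʳ-trans (^-mono-∣ π (ℕₚ.≤-trans (s≤s z≤n) eᵢB<N)) (π^N∣aⱼ j j≢i))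
      ... | no z≢i with em _ {y ≈ 0#}
      ...   | yes y≈0 = zDominates z≢i (∣y _) (∣ʳ-trans (∣y _) (x∣x^n y (0<e i (z≢i ∘ ≡.sym))))
        where
        ∣y : ∀ x → x ∣ y
        ∣y x = ∣ʳ-respʳ-≈ (sym y≈0) (x ∣0)
      ...   | no y≉0 with valuation y≉0
      ...     | V , vy with V ℕₚ.≤? B | ℕₚ.<-cmp (e i ℕ.* V) (N ℕ.+ B)
      -- Here `e i * V ≤ e i * B < N`, and `π ^ N` divides every other coefficient.
      ...       | yes V≤B | _ = iDominates (Val-^ (e i) vy) λ j j≢i →
        x∣y⇒x∣yz _ (∣ʳ-trans
          (^-mono-∣ π (ℕₚ.≤-<-trans (ℕₚ.*-monoʳ-≤ (e i) V≤B) eᵢB<N)) (π^N∣aⱼ j j≢i))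
      ...       | no V≰B | tri> _ _ N+B<eV =
        zDominates z≢i (Val⇒π^∣ (ℕₚ.≰⇒> V≰B) vy) (Val⇒π^∣ N+B<eV (Val-^ (e i) vy))
      ...       | no V≰B | tri≈ _ eV≡N+B _ =
        contradiction (ℕ∣.divides V (≡.trans (≡.sym eV≡N+B) (ℕₚ.*-comm (e i) V))) eᵢ∤N+B
      ...       | no V≰B | tri< eV<N+B _ _ =
        iDominates (Val-^ (e i) vy) other
        where
        other : ∀ j → j ≢ i → π ^ suc (e i ℕ.* V) ∣ term y j
        other j j≢i with j Finₚ.≟ z
        ... | yes ≡.refl = x∣y⇒x∣yz _ (Val⇒π^∣ eV<N+B (Val-aᶻ z≢i))
        ... | no  j≢z    = ∣ʳ-trans (^-mono-∣ π (s≤s (ℕₚ.<⇒≤ eV<N+B)))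
          (π^N+1+B∣term (Val⇒π^∣ (ℕₚ.≰⇒> V≰B) vy) j j≢i j≢z)

-- Numbers that avoid multiples of two given divisors.

open ℕ∣ using (_∣_)

k∣m∧k∣n+m⇒k∣n : ∀ {k} n {m} → k ∣ m → k ∣ n ℕ.+ m → k ∣ n
k∣m∧k∣n+m⇒k∣n {k} n {m} k∣m k∣n+m =
  ℕ∣.∣m+n∣m⇒∣n {m = m} (≡.subst (k ℕ∣.∣_) (ℕₚ.+-comm n m) k∣n+m) k∣m

∣2⇒≡1⊎≡2 : ∀ {k} → k ∣ 2 → k ≡ 1 ⊎ k ≡ 2
∣2⇒≡1⊎≡2 {0} k∣2 = contradiction (ℕ∣.0∣⇒≡0 k∣2) λ()
∣2⇒≡1⊎≡2 {1} _   = inj₁ ≡.refl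
∣2⇒≡1⊎≡2 {2} _   = inj₂ ≡.refl
∣2⇒≡1⊎≡2 {suc (suc (suc k))} k∣2 with ℕ∣.∣⇒≤ k∣2
... | s≤s (s≤s ())

module _ {p q : ℕ} (p≢1 : p ≢ 1) (q≢1 : q ≢ 1) where

  private
    ∤suc : ∀ {k m} → k ≢ 1 → k ∣ m → ¬ k ∣ suc m
    ∤suc k≢1 k∣m k∣1+m = k≢1 (ℕ∣.∣1⇒≡1 (k∣m∧k∣n+m⇒k∣n 1 k∣m k∣1+m))

    ∤2+ : ∀ {k m} → k ≢ 1 → k ≢ 2 → k ∣ m → ¬ k ∣ suc (suc m)
    ∤2+ k≢1 k≢2 k∣m k∣2+m with ∣2⇒≡1⊎≡2 (k∣m∧k∣n+m⇒k∣n 2 k∣m k∣2+m)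
    ... | inj₁ k≡1 = k≢1 k≡1
    ... | inj₂ k≡2 = k≢2 k≡2

    -- One of `S`, `S + 1`, `S + 2` works: if `p` divides `S + A`, it divides neither of the next
    -- two numbers, and `q` cannot divide both `S + 1 + B` and `S + 2 + B`. A divisor may be 0, as
    -- for an end coefficient, since 0 divides no successor.
    search : ∀ {S} A B → p ≢ 2 → ¬ q ∣ S ℕ.+ B →
             ∃[ N ] S ≤ N × ¬ p ∣ N ℕ.+ A × ¬ q ∣ N ℕ.+ B
    search {S} A B p≢2 q∤S+B with p ℕ∣.∣? S ℕ.+ A
    ... | no p∤S+A = S , ℕₚ.≤-refl , p∤S+A , q∤S+B
    ... | yes p∣S+A with q ℕ∣.∣? suc S ℕ.+ B
    ...   | no q∤1+S+B = suc S , ℕₚ.n≤1+n S , ∤suc p≢1 p∣S+A , q∤1+S+B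
    ...   | yes q∣1+S+B =
      suc (suc S) , ℕₚ.m≤n+m S 2 , ∤2+ p≢1 p≢2 p∣S+A , ∤suc q≢1 q∣1+S+B

  -- p divides at most one of three consecutive numbers, q at most one of two.
  avoidMultiples : p ≢ 2 → ∀ S A B → ∃[ N ] S ≤ N × ¬ p ∣ N ℕ.+ A × ¬ q ∣ N ℕ.+ B
  avoidMultiples p≢2 S A B with q ℕ∣.∣? S ℕ.+ B
  ... | no  q∤S+B = search A B p≢2 q∤S+B
  ... | yes q∣S+B with search A B p≢2 (∤suc q≢1 q∣S+B)
  ...   | N , 1+S≤N , rest = N , ℕₚ.<⇒≤ 1+S≤N , rest

-- Fields as integral domains.

module FieldLemmas (em : ∀ a → ExcludedMiddle a) {k ℓk} (K : CommutativeRing k ℓk)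
                   (isField : IsField K) where
  open RingLemmas K
  open IsField isField

  isIntegralDomain : IsIntegralDomain K
  isIntegralDomain = record
    { 1≉0            = 1≉0
    ; noZeroDivisors = noZeroDivisors
    }
    where
    noZeroDivisors : ∀ x y → x * y ≈ 0# → x ≈ 0# ⊎ y ≈ 0#
    noZeroDivisors x y xy≈0 with em _ {x ≈ 0#}
    ... | yes x≈0 = inj₁ x≈0
    ... | no  x≉0 with inverse x x≉0
    ...   | x⁻¹ , x⁻¹x≈1 , _ = inj₂ (begin
      y             ≈⟨ *-identityˡ y ⟨
      1# * y        ≈⟨ *-congʳ x⁻¹x≈1 ⟨
      x⁻¹ * x * y   ≈⟨ *-assoc x⁻¹ x y ⟩
      x⁻¹ * (x * y) ≈⟨ *-congˡ xy≈0 ⟩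
      x⁻¹ * 0#      ≈⟨ zeroʳ x⁻¹ ⟩
      0#            ∎)
      where open SetoidReasoning setoid

  open DomainLemmas K isIntegralDomain public

-- Polynomials over the fraction field.

module Polynomials (em : ∀ a → ExcludedMiddle a)
    {c ℓ k ℓk} (O : CommutativeRing c ℓ) (K : CommutativeRing k ℓk)
    (ι : CommutativeRing.Carrier O → CommutativeRing.Carrier K)
    (cdvr : IsCompleteDVR O) (isFractions : IsFieldOfFractions O K ι) where
  private
    module O where
      open RingLemmas O public
      open Valuation em O cdvr public
  open IsFieldOfFractions isFractions
  open IsField isField using (1≉0; inverse)
  open RingLemmas K
  open FieldLemmas em K isField
  open Morphisms.RingMorphisms O.rawRing rawRing using (module IsRingMonomorphism)
  open IsRingMonomorphism isRingMonomorphism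
    using (⟦⟧-cong; +-homo; *-homo; 0#-homo; 1#-homo; injective)
  open SetoidReasoning setoid

  ι≉0 : ∀ {x} → x O.≉ O.0# → ι x ≉ 0#
  ι≉0 x≉0 ιx≈0 = x≉0 (injective (trans ιx≈0 (sym 0#-homo)))

  ι-^ : ∀ x n → ι (x O.^ n) ≈ ι x ^ n
  ι-^ x zero    = 1#-homo
  ι-^ x (suc n) = trans (*-homo _ _) (*-congˡ (ι-^ x n))

  ι-sum : ∀ {n} (t : Fin n → O.Carrier) → ι (O.sum t) ≈ sum (ι ∘ t)
  ι-sum {zero}  t = 0#-homo
  ι-sum {suc n} t = trans (+-homo _ _) (+-congˡ (ι-sum (t ∘ suc)))

  -- Transfers nonvanishing from `O` to `K`. The factor `δ` clears denominators and, for the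
  -- reversed polynomial, also contains `y ^ d`.
  scaledSum≉0 : ∀ {n δ} (s : Fin n → Carrier) (t : Fin n → O.Carrier) →
                (∀ j → s j * δ ≈ ι (t j)) → O.sum t O.≉ O.0# → sum s ≉ 0#
  scaledSum≉0 {δ = δ} s t sδ≈ιt Σt≉0 Σs≈0 = ι≉0 Σt≉0 (begin
    ι (O.sum t)             ≈⟨ ι-sum t ⟩
    sum (ι ∘ t)             ≈⟨ sum-cong-≋ sδ≈ιt ⟨
    sum (λ j → s j * δ)     ≈⟨ *-distribʳ-sum δ s ⟨
    sum s * δ               ≈⟨ *-congʳ Σs≈0 ⟩
    0# * δ                  ≈⟨ zeroˡ δ ⟩
    0#                      ∎)

  -- Write `x` as `a / b`: of two elements of a valuation ring, one divides the other.
  integralOrInverseIntegral : ∀ x → (∃[ y ] x ≈ ι y) ⊎ (∃[ y ] x * ι y ≈ 1#)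
  integralOrInverseIntegral x with fraction x
  ... | a , b , b≉0 , xιb≈ιa with O.∣-total a b
  ...   | inj₂ (q O., qb≈a) = inj₁ (q , *-cancelʳ (ι≉0 b≉0) (begin
    x * ι b     ≈⟨ xιb≈ιa ⟩
    ι a         ≈⟨ ⟦⟧-cong qb≈a ⟨
    ι (q O.* b) ≈⟨ *-homo q b ⟩
    ι q * ι b   ∎))
  ...   | inj₁ (q O., qa≈b) = inj₂ (q , *-cancelʳ (ι≉0 a≉0) (begin
    x * ι q * ι a   ≈⟨ *-assoc x _ _ ⟩
    x * (ι q * ι a) ≈⟨ *-congˡ (*-homo q a) ⟨
    x * ι (q O.* a) ≈⟨ *-congˡ (⟦⟧-cong qa≈b) ⟩
    x * ι b         ≈⟨ xιb≈ιa ⟩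
    ι a             ≈⟨ *-identityˡ _ ⟨
    1# * ι a        ∎))
    where
    a≉0 : a O.≉ O.0#
    a≉0 a≈0 = b≉0 (O.trans (O.sym qa≈b) (O.trans (O.*-congˡ a≈0) (O.zeroʳ q)))

  clearDenominators : ∀ {n} (a : Fin n → Carrier) →
    ∃[ δ ] δ O.≉ O.0# × (∀ j → ∃[ b ] a j * ι δ ≈ ι b)
  clearDenominators {zero}  a = O.1# , O.1≉0 , λ ()
  clearDenominators {suc n} a with fraction (a zero) | clearDenominators (a ∘ suc)
  ... | r , s , s≉0 , a₀s≈r | δ , δ≉0 , aδ≈b =
    s O.* δ , O.x≉0∧y≉0⇒xy≉0 s≉0 δ≉0 , λ where
      zero → r O.* δ , (begin
        a zero * ι (s O.* δ)   ≈⟨ *-congˡ (*-homo s δ) ⟩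
        a zero * (ι s * ι δ)   ≈⟨ *-assoc _ _ _ ⟨
        a zero * ι s * ι δ     ≈⟨ *-congʳ a₀s≈r ⟩
        ι r * ι δ              ≈⟨ *-homo r δ ⟨
        ι (r O.* δ)            ∎)
      (suc j) → let b , aⱼδ≈b = aδ≈b j in s O.* b , (begin
        a (suc j) * ι (s O.* δ) ≈⟨ *-congˡ (*-homo s δ) ⟩
        a (suc j) * (ι s * ι δ) ≈⟨ x∙yz≈y∙xz _ _ _ ⟩
        ι s * (a (suc j) * ι δ) ≈⟨ *-congˡ aⱼδ≈b ⟩
        ι s * ι b               ≈⟨ *-homo s b ⟨
        ι (s O.* b)             ∎)

  module _ {d} (a : Fin (suc d) → Carrier) {δ} (c : Fin (suc d) → O.Carrier)
           (aδ≈c : ∀ j → a j * ι δ ≈ ι (c j)) where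

    scaledTerm : ∀ {x y} → x ≈ ι y → ∀ j →
                 a j * x ^ toℕ j * ι δ ≈ ι (c j O.* y O.^ toℕ j)
    scaledTerm {x} {y} x≈ιy j = begin
      a j * x ^ toℕ j * ι δ       ≈⟨ xy∙z≈xz∙y _ _ _ ⟩
      a j * ι δ * x ^ toℕ j       ≈⟨ *-cong (aδ≈c j) (^-congˡ (toℕ j) x≈ιy) ⟩
      ι (c j) * ι y ^ toℕ j       ≈⟨ *-congˡ (ι-^ y (toℕ j)) ⟨
      ι (c j) * ι (y O.^ toℕ j)   ≈⟨ *-homo _ _ ⟨
      ι (c j O.* y O.^ toℕ j)     ∎

    -- As `y` is the inverse of `x`, multiplying by `y ^ d` turns `x ^ j` into `y ^ (d - j)`.
    reversedTerm : ∀ {x y} → x * ι y ≈ 1# → ∀ j →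
                   a j * x ^ toℕ j * (ι δ * ι y ^ d) ≈ ι (c j O.* y O.^ (d ℕ.∸ toℕ j))
    reversedTerm {x} {y} xιy≈1 j = begin
      a j * x ^ toℕ j * (ι δ * ι y ^ d)           ≈⟨ interchange _ _ _ _ ⟩
      a j * ι δ * (x ^ toℕ j * ι y ^ d)           ≈⟨ *-cong (aδ≈c j) x^jy^d≈y^d-j ⟩
      ι (c j) * ι y ^ (d ℕ.∸ toℕ j)               ≈⟨ *-congˡ (ι-^ y (d ℕ.∸ toℕ j)) ⟨
      ι (c j) * ι (y O.^ (d ℕ.∸ toℕ j))           ≈⟨ *-homo _ _ ⟨
      ι (c j O.* y O.^ (d ℕ.∸ toℕ j))             ∎
      where
      1^n≈1 : ∀ n → 1# ^ n ≈ 1#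
      1^n≈1 zero    = refl
      1^n≈1 (suc n) = trans (*-identityˡ _) (1^n≈1 n)

      x^jy^d≈y^d-j : x ^ toℕ j * ι y ^ d ≈ ι y ^ (d ℕ.∸ toℕ j)
      x^jy^d≈y^d-j = begin
        x ^ toℕ j * ι y ^ d
          ≡⟨ ≡.cong (λ n → x ^ toℕ j * ι y ^ n) (ℕₚ.m+[n∸m]≡n (Finₚ.toℕ≤pred[n] j)) ⟨
        x ^ toℕ j * ι y ^ (toℕ j ℕ.+ (d ℕ.∸ toℕ j))
          ≈⟨ *-congˡ (^-homo-* (ι y) (toℕ j) _) ⟩
        x ^ toℕ j * (ι y ^ toℕ j * ι y ^ (d ℕ.∸ toℕ j))
          ≈⟨ *-assoc _ _ _ ⟨
        x ^ toℕ j * ι y ^ toℕ j * ι y ^ (d ℕ.∸ toℕ j)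
          ≈⟨ *-congʳ (^-distrib-* x (ι y) (toℕ j)) ⟨
        (x * ι y) ^ toℕ j * ι y ^ (d ℕ.∸ toℕ j)
          ≈⟨ *-congʳ (^-congˡ (toℕ j) xιy≈1) ⟩
        1# ^ toℕ j * ι y ^ (d ℕ.∸ toℕ j)
          ≈⟨ *-congʳ (1^n≈1 (toℕ j)) ⟩
        1# * ι y ^ (d ℕ.∸ toℕ j)
          ≈⟨ *-identityˡ _ ⟩
        ι y ^ (d ℕ.∸ toℕ j) ∎

  eval : ∀ {n} → (Fin n → Carrier) → Carrier → Carrier
  eval a x = sum λ j → a j * x ^ toℕ j

  d-j≡0 : ∀ d → d ℕ.∸ toℕ (fromℕ d) ≡ 0
  d-j≡0 d = ≡.trans (≡.cong (d ℕ.∸_) (Finₚ.toℕ-fromℕ d)) (ℕₚ.n∸n≡0 d)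

  0<toℕ : ∀ {n} (j : Fin (suc n)) → j ≢ zero → 0 < toℕ j
  0<toℕ zero    0≢0 = contradiction ≡.refl 0≢0
  0<toℕ (suc j) _   = s≤s z≤n

  0<d-j : ∀ {d} (j : Fin (suc d)) → j ≢ fromℕ d → 0 < d ℕ.∸ toℕ j
  0<d-j {d} j j≢d = ℕₚ.m<n⇒0<n∸m (ℕₚ.≤∧≢⇒< (Finₚ.toℕ≤pred[n] j) λ j≡d →
    j≢d (Finₚ.toℕ-injective (≡.trans j≡d (≡.sym (Finₚ.toℕ-fromℕ d)))))

  integer≉0 : ∀ {x y b} → x * ι y ≈ ι b → b O.≉ O.0# → x ≉ 0#
  integer≉0 xιy≈b b≉0 x≈0 =
    ι≉0 b≉0 (trans (sym xιy≈b) (trans (*-congʳ x≈0) (zeroˡ _)))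

  numerator≉0 : ∀ {x y b} → y O.≉ O.0# → x * ι y ≈ ι b → x ≉ 0# → b O.≉ O.0#
  numerator≉0 y≉0 xιy≈b x≉0 b≈0 =
    x≉0∧y≉0⇒xy≉0 x≉0 (ι≉0 y≉0) (trans xιy≈b (trans (⟦⟧-cong b≈0) 0#-homo))

  -- A nonzero constant term dominates at a high power of `π`. A nonzero leading coefficient
  -- dominates at the inverse of such a power, where the reversed polynomial is used.
  nonzeroNonRoot : ∀ {d} (a : Fin (suc d) → Carrier) → a zero ≉ 0# ⊎ a (fromℕ d) ≉ 0# →
                   ∃[ x ] x ≉ 0# × eval a x ≉ 0#
  nonzeroNonRoot {d} a end≉0 with clearDenominators a
  ... | δ , δ≉0 , aδ≈b with end≉0
  ...   | inj₁ a₀≉0 with O.valuation (numerator≉0 δ≉0 (proj₂ (aδ≈b zero)) a₀≉0)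
  ...     | B , v = ι (O.π O.^ suc B) , ι≉0 (O.π^n≉0 (suc B)) , scaledSum≉0 _ _
    (scaledTerm a (proj₁ ∘ aδ≈b) (proj₂ ∘ aδ≈b) refl)
    (O.nonRoot (proj₁ ∘ aδ≈b) toℕ zero ≡.refl 0<toℕ v)
  nonzeroNonRoot {d} a end≉0 | δ , δ≉0 , aδ≈b | inj₂ aₙ≉0
    with O.valuation (numerator≉0 δ≉0 (proj₂ (aδ≈b (fromℕ d))) aₙ≉0)
  ... | B , v with inverse (ι (O.π O.^ suc B)) (ι≉0 (O.π^n≉0 (suc B)))
  ...   | x , xιy≈1 , _ = x , integer≉0 (trans xιy≈1 (sym 1#-homo)) O.1≉0 , scaledSum≉0 _ _
    (reversedTerm a (proj₁ ∘ aδ≈b) (proj₂ ∘ aδ≈b) xιy≈1)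
    (O.nonRoot (proj₁ ∘ aδ≈b) (λ j → d ℕ.∸ toℕ j) (fromℕ d) (d-j≡0 d) 0<d-j v)

  -- The effect of one move, stated for coefficient functions so that the algebra does not mention
  -- positions.
  Updates : ∀ {n} → (Fin n → Carrier) → Fin n → Carrier → (Fin n → Carrier) → Set _
  Updates a i v a′ = a′ i ≡ v × (∀ j → j ≢ i → a′ j ≡ a j)

  eval-update : ∀ {n} {a a′ : Fin (suc n) → Carrier} {i v} → a i ≈ 0# → Updates a i v a′ →
                ∀ x → eval a′ x ≈ v * x ^ toℕ i + eval a x
  eval-update {a = a} {a′} {i} {v} aᵢ≈0 (a′ᵢ≡v , a′ⱼ≡aⱼ) x = begin
    eval a′ x  ≈⟨ sum-remove (λ j → a′ j * x ^ toℕ j) ⟩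
    a′ i * x ^ toℕ i + sum (λ j → a′ (punchIn i j) * x ^ toℕ (punchIn i j))
      ≈⟨ +-cong (*-congʳ (reflexive a′ᵢ≡v)) (sum-cong-≋ λ j →
           *-congʳ (reflexive (a′ⱼ≡aⱼ _ (Finₚ.punchInᵢ≢i i j)))) ⟩
    v * x ^ toℕ i + rest  ≈⟨ +-congˡ (+-identityˡ rest) ⟨
    v * x ^ toℕ i + (0# + rest)
      ≈⟨ +-congˡ (+-congʳ (trans (*-congʳ aᵢ≈0) (zeroˡ _))) ⟨
    v * x ^ toℕ i + (a i * x ^ toℕ i + rest)  ≈⟨ +-congˡ (sum-remove (λ j → a j * x ^ toℕ j)) ⟨
    v * x ^ toℕ i + eval a x ∎
    where rest = sum (λ j → a (punchIn i j) * x ^ toℕ (punchIn i j))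

  -- Since `x` is not a root of the polynomial with 0 at `i`, the value that makes it a root is
  -- nonzero, hence legal even for an end coefficient.
  rootMove : ∀ {d} (a : Fin (suc d) → Carrier) i → a i ≈ 0# →
             a zero ≉ 0# ⊎ a (fromℕ d) ≉ 0# →
             ∃[ v ] v ≉ 0# × (∀ {a′} → Updates a i v a′ → ∃[ x ] eval a′ x ≈ 0#)
  rootMove a i aᵢ≈0 end≉0 with nonzeroNonRoot a end≉0
  ... | x , x≉0 , g≉0 with inverse (x ^ toℕ i) (x≉0⇒x^n≉0 (toℕ i) x≉0)
  ...   | r , rxⁱ≈1 , _ = - eval a x * r , v≉0 , λ {a′} upd → x , (begin
      eval a′ x                                  ≈⟨ eval-update aᵢ≈0 upd x ⟩
      - eval a x * r * x ^ toℕ i + eval a x      ≈⟨ +-congʳ vxⁱ≈-g ⟩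
      - eval a x + eval a x                      ≈⟨ -‿inverseˡ _ ⟩
      0#                                         ∎)
    where
    vxⁱ≈-g : - eval a x * r * x ^ toℕ i ≈ - eval a x
    vxⁱ≈-g = trans (*-assoc _ _ _) (trans (*-congˡ rxⁱ≈1) (*-identityʳ _))

    v≉0 : - eval a x * r ≉ 0#
    v≉0 v≈0 = g≉0 (begin
      eval a x                    ≈⟨ +-identityʳ _ ⟨
      eval a x + 0#               ≈⟨ +-congˡ (trans (sym (zeroˡ _)) (trans (*-congʳ (sym v≈0)) vxⁱ≈-g)) ⟩
      eval a x + - eval a x       ≈⟨ -‿inverseʳ _ ⟩
      0#                          ∎)

  -- The value is the inverse of `π ^ N * δ`, where `δ` is a common denominator. Multiplying by
  -- `π ^ N * δ` brings the polynomial and its reversal into the form treated by `noRoot`.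
  rootlessMove : ∀ {d} → d > 4 → (a : Fin (suc d) → Carrier) (i : Fin (suc d)) →
                 toℕ i ≢ 1 → d ℕ.∸ toℕ i ≢ 1 →
                 (zero ≢ i → a zero ≉ 0#) → (fromℕ d ≢ i → a (fromℕ d) ≉ 0#) →
                 ∃[ v ] v ≉ 0# × (∀ {a′} → Updates a i v a′ → ¬ (∃[ x ] eval a′ x ≈ 0#))
  rootlessMove {d} d>4 a i i≢1 d-i≢1 a₀≉0 aₙ≉0 with clearDenominators a
  ... | δ , δ≉0 , aδ≈b = v , integer≉0 vδ′≈1 O.1≉0 , rootless
    where
    b : Fin (suc d) → O.Carrier
    b = proj₁ ∘ aδ≈b

    endVal : ∀ z → (z ≢ i → a z ≉ 0#) → ∃[ B ] (z ≢ i → O.Val (b z) B)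
    endVal z az≉0 with z Finₚ.≟ i
    -- The end coefficient is the one being chosen and has no valuation yet; 0 is a placeholder.
    ... | yes z≡i = 0 , λ z≢i → contradiction z≡i z≢i
    ... | no  z≢i with O.valuation (numerator≉0 δ≉0 (proj₂ (aδ≈b z)) (az≉0 z≢i))
    ...   | B , v = B , λ _ → v

    B₀ = proj₁ (endVal zero a₀≉0)
    Bₙ = proj₁ (endVal (fromℕ d) aₙ≉0)

    -- From here on `N` exceeds `e i * B` for both choices of exponents and end valuations.
    S = suc (d ℕ.* (B₀ ℕ.+ Bₙ))

    choice : ∃[ N ] S ≤ N × ¬ toℕ i ℕ∣.∣ N ℕ.+ B₀ × ¬ d ℕ.∸ toℕ i ℕ∣.∣ N ℕ.+ Bₙ
    choice with toℕ i ℕₚ.≟ 2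
    ... | no i≢2 = avoidMultiples i≢1 d-i≢1 i≢2 S B₀ Bₙ
    -- `avoidMultiples` wants its first divisor different from 2, so the two ends swap roles; both
    -- divisors being 2 would force `d = 4`.
    ... | yes i≡2 with avoidMultiples d-i≢1 i≢1 d-i≢2 S Bₙ B₀
      where
      d-i≢2 : d ℕ.∸ toℕ i ≢ 2
      d-i≢2 d-i≡2 = ℕₚ.<⇒≢ d>4 (≡.trans (≡.sym (≡.cong₂ ℕ._+_ i≡2 d-i≡2))
                                         (ℕₚ.m+[n∸m]≡n (Finₚ.toℕ≤pred[n] i)))
    ...   | N , S≤N , ∤ₙ , ∤₀ = N , S≤N , ∤₀ , ∤ₙ

    N = proj₁ choice
    δ′ = O.π O.^ N O.* δ

    small : ∀ {e B} → e ≤ d → B ≤ B₀ ℕ.+ Bₙ → e ℕ.* B < N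
    small e≤d B≤ = ℕₚ.≤-trans (s≤s (ℕₚ.*-mono-≤ e≤d B≤)) (proj₁ (proj₂ choice))

    inv = inverse (ι δ′) (ι≉0 (O.x≉0∧y≉0⇒xy≉0 (O.π^n≉0 N) δ≉0))
    v = proj₁ inv

    vδ′≈1 : v * ι δ′ ≈ ι O.1#
    vδ′≈1 = trans (proj₁ (proj₂ inv)) (sym 1#-homo)

    module _ {a′ : Fin (suc d) → Carrier} (upd : Updates a i v a′) where

      scaled : ∀ j → ∃[ b′ ] a′ j * ι δ′ ≈ ι b′ × (j ≡ i → b′ O.≈ O.1#) ×
                            (j ≢ i → O.π O.^ N O.* b j O.≈ b′)
      scaled j with j Finₚ.≟ i
      ... | yes ≡.refl = O.1# , trans (*-congʳ (reflexive (proj₁ upd))) vδ′≈1 ,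
        (λ _ → O.refl) , contradiction ≡.refl
      ... | no j≢i = O.π O.^ N O.* b j , (begin
        a′ j * ι δ′                      ≈⟨ *-cong (reflexive (proj₂ upd j j≢i)) (*-homo _ δ) ⟩
        a j * (ι (O.π O.^ N) * ι δ)      ≈⟨ x∙yz≈y∙xz _ _ _ ⟩
        ι (O.π O.^ N) * (a j * ι δ)      ≈⟨ *-congˡ (proj₂ (aδ≈b j)) ⟩
        ι (O.π O.^ N) * ι (b j)          ≈⟨ *-homo _ _ ⟨
        ι (O.π O.^ N O.* b j)            ∎) ,
        (λ j≡i → contradiction j≡i j≢i) , λ _ → O.refl

      b′ : Fin (suc d) → O.Carrier
      b′ = proj₁ ∘ scaled

      a′δ′≈b′ : ∀ j → a′ j * ι δ′ ≈ ι (b′ j)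
      a′δ′≈b′ = proj₁ ∘ proj₂ ∘ scaled

      -- Covers both the polynomial and its reversal; the factor `π ^ N` raises the valuation of the
      -- end coefficient from `B` to `N + B`.
      b′-sum≉0 : ∀ (e : Fin (suc d) → ℕ) z B → e z ≡ 0 → (∀ j → j ≢ z → 0 < e j) →
                (z ≢ i → O.Val (b z) B) → e i ≤ d → B ≤ B₀ ℕ.+ Bₙ →
                ¬ e i ℕ∣.∣ N ℕ.+ B → ∀ y → O.sum (λ j → b′ j O.* y O.^ e j) O.≉ O.0#
      b′-sum≉0 e z B eᶻ≡0 0<e vb eᵢ≤d B≤ eᵢ∤N+B =
        O.noRoot b′ e z eᶻ≡0 0<e i N B
          (proj₁ (proj₂ (proj₂ (scaled i))) ≡.refl)
          (λ j j≢i → O.∣ʳ-respʳ-≈ (proj₂ (proj₂ (proj₂ (scaled j))) j≢i) (O.x∣xy _ (b j)))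
          (λ z≢i → O.Val-resp-≈ (proj₂ (proj₂ (proj₂ (scaled z))) z≢i)
                     (O.Val-* (O.Val-π^ N) (vb z≢i)))
          (small eᵢ≤d B≤) eᵢ∤N+B

      rootless : ¬ (∃[ x ] eval a′ x ≈ 0#)
      rootless (x , root) with integralOrInverseIntegral x
      ... | inj₁ (y , x≈ιy) = scaledSum≉0 _ _ (scaledTerm a′ b′ a′δ′≈b′ x≈ιy)
        (b′-sum≉0 toℕ zero B₀ ≡.refl 0<toℕ (proj₂ (endVal zero a₀≉0))
          (Finₚ.toℕ≤pred[n] i) (ℕₚ.m≤m+n B₀ Bₙ) (proj₁ (proj₂ (proj₂ choice))) y) root
      ... | inj₂ (y , xιy≈1) = scaledSum≉0 _ _ (reversedTerm a′ b′ a′δ′≈b′ xιy≈1)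
        (b′-sum≉0 (λ j → d ℕ.∸ toℕ j) (fromℕ d) Bₙ (d-j≡0 d) 0<d-j
          (proj₂ (endVal (fromℕ d) aₙ≉0))
          (ℕₚ.m∸n≤m d (toℕ i)) (ℕₚ.m≤n+m Bₙ B₀) (proj₂ (proj₂ (proj₂ choice))) y) root

-- Unchosen entries of a position.

module _ {a} {A : Set a} where

  blanks : ∀ {n} → Vec (Maybe A) n → ℕ
  blanks []             = 0
  blanks (just _  ∷ xs) = blanks xs
  blanks (nothing ∷ xs) = suc (blanks xs)

  blanks-replicate : ∀ n → blanks (replicate n nothing) ≡ n
  blanks-replicate zero    = ≡.refl
  blanks-replicate (suc n) = ≡.cong suc (blanks-replicate n)

  blanks-update : ∀ {n} (xs : Vec (Maybe A) n) i {x} → lookup xs i ≡ nothing →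
                  suc (blanks (xs [ i ]≔ just x)) ≡ blanks xs
  blanks-update (nothing ∷ xs) zero    _  = ≡.refl
  blanks-update (just _  ∷ xs) (suc i) eq = blanks-update xs i eq
  blanks-update (nothing ∷ xs) (suc i) eq = ≡.cong suc (blanks-update xs i eq)

  blanks≢0⇒∃nothing : ∀ {n} (xs : Vec (Maybe A) n) → blanks xs ≢ 0 →
                      ∃[ i ] lookup xs i ≡ nothing
  blanks≢0⇒∃nothing []             ≢0 = contradiction ≡.refl ≢0
  blanks≢0⇒∃nothing (nothing ∷ xs) _  = zero , ≡.refl
  blanks≢0⇒∃nothing (just _  ∷ xs) ≢0 with blanks≢0⇒∃nothing xs ≢0
  ... | i , eq = suc i , eq

  blanks≡0⇒just : ∀ {n} (xs : Vec (Maybe A) n) → blanks xs ≡ 0 →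
                  ∀ i → ∃[ x ] lookup xs i ≡ just x
  blanks≡0⇒just (just x ∷ xs) _  zero    = x , ≡.refl
  blanks≡0⇒just (just x ∷ xs) eq (suc i) = blanks≡0⇒just xs eq i

  -- Filling entry `i` with an arbitrary element leaves no blanks and does not affect entry `j`.
  blanks≡1⇒just : ∀ {n} (xs : Vec (Maybe A) n) → blanks xs ≡ 1 →
                  ∀ {i j} → lookup xs i ≡ nothing → j ≢ i → A → ∃[ x ] lookup xs j ≡ just x
  blanks≡1⇒just xs ≡1 {i} {j} eq j≢i x
    with blanks≡0⇒just (xs [ i ]≔ just x) (ℕₚ.suc-injective (≡.trans (blanks-update xs i eq) ≡1)) j
  ... | y , eq′ = y , ≡.trans (≡.sym (Vecₚ.lookup∘update′ j≢i xs (just x))) eq′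

opponent-involutive : ∀ P → opponent (opponent P) ≡ P
opponent-involutive nora  = ≡.refl
opponent-involutive wanda = ≡.refl

opponent-≢ : ∀ P → opponent P ≢ P
opponent-≢ nora  ()
opponent-≢ wanda ()

-- Plays and strategies of the last mover.

module GameLemmas (em : ∀ a → ExcludedMiddle a) {k ℓk} (K : CommutativeRing k ℓk)
                  (isField : IsField K) (d : ℕ) (first : Player) where
  open CommutativeRing K hiding (zero)
  open IsField isField using (1≉0)
  open Game K d
  open LegalMove

  private
    last = lastMover first d

  Play⇒blanks : ∀ {n pos} → Play n pos → n ℕ.+ blanks pos ≡ suc d
  Play⇒blanks start = blanks-replicate (suc d)
  Play⇒blanks (_▷_ {n} {pos} h m) = ≡.trans (≡.sym (ℕₚ.+-suc n _))
    (≡.trans (≡.cong (n ℕ.+_) (blanks-update pos (index m) (unchosen m))) (Play⇒blanks h))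

  lastBlank : ∀ {pos} → Play d pos → blanks pos ≡ 1
  lastBlank {pos} h = ℕₚ.+-cancelˡ-≡ d _ _ (≡.trans (Play⇒blanks h) (ℕₚ.+-comm 1 d))

  End : Fin (suc d) → Set
  End j = toℕ j ≡ 0 ⊎ toℕ j ≡ d

  -- Going back through the play leads to the move that chose `j`, and its legality gives the claim.
  end≉0 : ∀ {n pos} → Play n pos → ∀ {j v} → End j → lookup pos j ≡ just v → v ≉ 0#
  end≉0 start {j} _ eq with ≡.trans (≡.sym eq) (Vecₚ.lookup-replicate j nothing)
  ... | ()
  end≉0 (_▷_ {pos = pos} h m) {j} endⱼ eq with j Finₚ.≟ index m
  ... | no j≢i = end≉0 h endⱼ (≡.trans (≡.sym (Vecₚ.lookup∘update′ j≢i pos _)) eq)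
  ... | yes ≡.refl with ≡.trans (≡.sym eq) (Vecₚ.lookup∘update j pos _)
  ...   | ≡.refl = nonzero m endⱼ

  lastCoefficients≉0 : ∀ {pos} → Play d pos → ∀ {i} → lookup pos i ≡ nothing →
                       ∀ {j} → End j → j ≢ i → coefficient pos j ≉ 0#
  lastCoefficients≉0 {pos} h unchosenᵢ {j} endⱼ j≢i
    with blanks≡1⇒just pos (lastBlank h) unchosenᵢ j≢i 0#
  ... | v , eq = λ c≈0 → end≉0 h endⱼ eq
    (trans (reflexive (≡.cong (fromMaybe 0#) (≡.sym eq))) c≈0)

  playOne : ∀ {pos} i → lookup pos i ≡ nothing → LegalMove pos
  playOne i unchosenᵢ = record
    { index = i ; value = 1# ; unchosen = unchosenᵢ ; nonzero = λ _ → 1≉0 }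

  anyUnchosen : ∀ {n pos} → Play n pos → n < suc d → ∃[ i ] lookup pos i ≡ nothing
  anyUnchosen {n} {pos} h n<1+d = blanks≢0⇒∃nothing pos λ ≡0 →
    ℕₚ.<⇒≢ n<1+d (≡.trans (≡.sym (ℕₚ.+-identityʳ n))
      (≡.trans (≡.cong (n ℕ.+_) (≡.sym ≡0)) (Play⇒blanks h)))

  WinningMove : Position → Set _
  WinningMove pos = Σ[ m ∈ LegalMove pos ] Wins last (makeMove pos m)

  private
    winningMove? : ∀ pos → Dec (WinningMove pos)
    winningMove? pos = em _

    winIfPossible : ∀ {pos} → LegalMove pos → Dec (WinningMove pos) → LegalMove pos
    winIfPossible _ (yes (m , _)) = m
    winIfPossible m (no _)        = m

    winIfPossible-wins : ∀ {pos} (m : LegalMove pos) → WinningMove pos →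
                         (w? : Dec (WinningMove pos)) →
                         Wins last (makeMove pos (winIfPossible m w?))
    winIfPossible-wins _ _ (yes (_ , w)) = w
    winIfPossible-wins _ w (no ¬w)       = contradiction w ¬w

  -- A strategy must answer every play, including those where no winning move exists. Excluded
  -- middle therefore decides at the last move whether there is one, and `σ` supplies the fallback.
  finish : Strategy first last → Strategy first last
  finish σ {n} {pos} h n<1+d turn with n ℕₚ.≟ d
  ... | yes _ = winIfPossible (σ h n<1+d turn) (winningMove? pos)
  ... | no  _ = σ h n<1+d turn

  finish-early : ∀ (σ : Strategy first last) {n pos} (h : Play n pos) n<1+d turn → n ≢ d →
                 finish σ h n<1+d turn ≡ σ h n<1+d turn
  finish-early σ {n} h n<1+d turn n≢d with n ℕₚ.≟ d
  ... | yes n≡d = contradiction n≡d n≢d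
  ... | no  _   = ≡.refl

  finish-last : ∀ (σ : Strategy first last) {pos} (h : Play d pos) d<1+d turn →
                WinningMove pos → Wins last (makeMove pos (finish σ h d<1+d turn))
  finish-last σ {pos} h d<1+d turn w with d ℕₚ.≟ d
  ... | yes _  = winIfPossible-wins (σ h d<1+d turn) w (winningMove? pos)
  ... | no d≢d = contradiction ≡.refl d≢d

  -- The last mover is by definition to move after `d` moves, so it suffices that a winning move
  -- exists there in every play that follows the strategy.
  finish-winning : ∀ (σ : Strategy first last) →
    (∀ {pos} {h : Play d pos} → Follows first last (finish σ) h → WinningMove pos) →
    HasWinningStrategy first last
  finish-winning σ win = finish σ , winning
    where
    winning : IsWinning first last (finish σ)
    winning (own {h = h} f d<1+d turn)  = finish-last σ h d<1+d turn (win f)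
    winning (opposing _ notTurn _)      = contradiction ≡.refl notTurn

  Chosen : Fin (suc d) → Position → Set k
  Chosen j pos = lookup pos j ≢ nothing

  makeMove-chosen : ∀ {pos} m {j} → Chosen j pos → Chosen j (makeMove pos m)
  makeMove-chosen {pos} m {j} chosen eq with j Finₚ.≟ index m
  ... | no j≢i = chosen (≡.trans (≡.sym (Vecₚ.lookup∘update′ j≢i pos _)) eq)
  ... | yes ≡.refl with ≡.trans (≡.sym eq) (Vecₚ.lookup∘update j pos _)
  ...   | ()

  makeMove-index : ∀ {pos} (m : LegalMove pos) → Chosen (index m) (makeMove pos m)
  makeMove-index {pos} m eq with ≡.trans (≡.sym eq) (Vecₚ.lookup∘update (index m) pos _)
  ... | ()

  module _ (i₁ i₂ : Fin (suc d)) where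

    -- Records the order of priority: `i₁` if it is free, then `i₂`, then any other coefficient.
    data Chooses {pos} (m : LegalMove pos) : Set (k ⊔ ℓk) where
      picks₁    : index m ≡ i₁ → Chooses m
      picks₂    : Chosen i₁ pos → index m ≡ i₂ → Chooses m
      picksRest : Chosen i₁ pos → Chosen i₂ pos → Chooses m

    prefer : ∀ {pos} → LegalMove pos → Σ[ m ∈ LegalMove pos ] Chooses m
    prefer {pos} m with em _ {lookup pos i₁ ≡ nothing} | em _ {lookup pos i₂ ≡ nothing}
    ... | yes eq | _      = playOne i₁ eq , picks₁ ≡.refl
    ... | no c₁  | yes eq = playOne i₂ eq , picks₂ c₁ ≡.refl
    ... | no c₁  | no c₂  = m , picksRest c₁ c₂

    chooses₁ : ∀ {pos} {m : LegalMove pos} → Chooses m → Chosen i₁ (makeMove pos m)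
    chooses₁ {m = m} (picks₁ ≡.refl)  = makeMove-index m
    chooses₁ {m = m} (picks₂ c₁ _)   = makeMove-chosen m c₁
    chooses₁ {m = m} (picksRest c₁ _)    = makeMove-chosen m c₁

    chooses₂ : ∀ {pos} {m : LegalMove pos} → Chooses m → Chosen i₁ pos →
               Chosen i₂ (makeMove pos m)
    chooses₂ {m = m} (picks₁ ≡.refl)    c₁ = contradiction (unchosen m) c₁
    chooses₂ {m = m} (picks₂ _ ≡.refl) _  = makeMove-index m
    chooses₂ {m = m} (picksRest _ c₂)      _  = makeMove-chosen m c₂

    preferential : Strategy first last
    preferential h n<1+d turn =
      let i , unchosenᵢ = anyUnchosen h n<1+d in proj₁ (prefer (playOne i unchosenᵢ))

    finish-preferential : ∀ {n pos} (h : Play n pos) n<1+d turn → n ≢ d →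
                          Chooses (finish preferential h n<1+d turn)
    finish-preferential h n<1+d turn n≢d = ≡.subst Chooses
      (≡.sym (finish-early preferential h n<1+d turn n≢d))
      (proj₂ (prefer (playOne _ (proj₂ (anyUnchosen h n<1+d)))))

    -- A round is a move of the last mover and the reply. It secures `i₁`, and also `i₂` if `i₁` was
    -- chosen before the round, so two rounds secure both.
    twoPlies : ∀ {n pos} {h : Play (suc (suc n)) pos} → toMove first n ≡ last → n < d →
               Follows first last (finish preferential) h →
               Σ[ pos₀ ∈ Position ] Σ[ h₀ ∈ Play n pos₀ ]
                 Follows first last (finish preferential) h₀ × Chosen i₁ pos ×
                 (Chosen i₁ pos₀ → Chosen i₂ pos)
    twoPlies turn n<d (opposing (own {h = h₀} f n<1+d turn′) _ m) =
      _ , h₀ , f , makeMove-chosen m (chooses₁ ch) ,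
      λ c₁ → makeMove-chosen m (chooses₂ ch c₁)
      where ch = finish-preferential h₀ n<1+d turn′ (ℕₚ.<⇒≢ n<d)
    twoPlies turn _ (opposing (opposing _ notTurn _) _ _) = contradiction turn notTurn
    twoPlies {n} turn _ (own _ _ turn′) =
      contradiction (≡.trans turn′ (≡.sym turn)) (opponent-≢ (toMove first n))

-- The winning last move and the complete strategy.

module LastMove (em : ∀ a → ExcludedMiddle a)
    {c ℓ k ℓk} (O : CommutativeRing c ℓ) (K : CommutativeRing k ℓk)
    (ι : CommutativeRing.Carrier O → CommutativeRing.Carrier K)
    (cdvr : IsCompleteDVR O) (isFractions : IsFieldOfFractions O K ι)
    (d : ℕ) (d>4 : d > 4) (first : Player) where
  open CommutativeRing K hiding (zero)
  open Polynomials em O K ι cdvr isFractions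
  open Game K d
  open GameLemmas em K (IsFieldOfFractions.isField isFractions) d first

  private
    end-d : End (fromℕ d)
    end-d = inj₂ (Finₚ.toℕ-fromℕ d)

    0≢fromℕd : zero ≢ fromℕ d
    0≢fromℕd 0≡d = ℕₚ.<⇒≢ (ℕₚ.<-trans (s≤s z≤n) d>4) (≡.trans (≡.cong toℕ 0≡d) (Finₚ.toℕ-fromℕ d))

  coefficient-unchosen : ∀ pos {i} → lookup pos i ≡ nothing → coefficient pos i ≈ 0#
  coefficient-unchosen pos eq = reflexive (≡.cong (fromMaybe 0#) eq)

  coefficient-update : ∀ pos i v →
    Updates (coefficient pos) i v (coefficient (pos [ i ]≔ just v))
  coefficient-update pos i v =
    ≡.cong (fromMaybe 0#) (Vecₚ.lookup∘update i pos _) ,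
    λ j j≢i → ≡.cong (fromMaybe 0#) (Vecₚ.lookup∘update′ j≢i pos _)

  moveTo : ∀ {pos i v} → lookup pos i ≡ nothing → v ≉ 0# → LegalMove pos
  moveTo {i = i} {v} eq v≉0 = record
    { index = i ; value = v ; unchosen = eq ; nonzero = const v≉0 }

  wandaWins : ∀ {pos} → Play d pos → Σ[ m ∈ LegalMove pos ] Wins wanda (makeMove pos m)
  wandaWins {pos} h with anyUnchosen h ℕₚ.≤-refl
  ... | i , eq with rootMove (coefficient pos) i (coefficient-unchosen pos eq) end≉0′
    where
    end≉0′ : coefficient pos zero ≉ 0# ⊎ coefficient pos (fromℕ d) ≉ 0#
    -- Only one coefficient is free, so at least one of the two ends has been chosen.
    end≉0′ with zero Finₚ.≟ i
    ... | yes ≡.refl = inj₂ (lastCoefficients≉0 h eq end-d (0≢fromℕd ∘ ≡.sym))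
    ... | no  0≢i    = inj₁ (lastCoefficients≉0 h eq (inj₁ ≡.refl) 0≢i)
  ...   | v , v≉0 , root = moveTo eq v≉0 , root (coefficient-update pos i v)

  noraWins : ∀ {pos} → Play d pos → (∀ i → lookup pos i ≡ nothing → toℕ i ≢ 1 × d ℕ.∸ toℕ i ≢ 1) →
             Σ[ m ∈ LegalMove pos ] Wins nora (makeMove pos m)
  noraWins {pos} h inner with anyUnchosen h ℕₚ.≤-refl
  ... | i , eq with rootlessMove d>4 (coefficient pos) i (proj₁ (inner i eq)) (proj₂ (inner i eq))
                      (lastCoefficients≉0 h eq (inj₁ ≡.refl))
                      (lastCoefficients≉0 h eq end-d)
  ...   | v , v≉0 , rootless = moveTo eq v≉0 , rootless (coefficient-update pos i v)

theorem5 : (∀ a → ExcludedMiddle a) →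
    ∀ {c ℓ k ℓk} (O : CommutativeRing c ℓ) (K : CommutativeRing k ℓk)
    (ι : CommutativeRing.Carrier O → CommutativeRing.Carrier K) →
    IsCompleteDVR O → IsFieldOfFractions O K ι →
    (d : ℕ) → d > 4 → (first : Player) →
    Game.HasWinningStrategy K d first (lastMover first d)
theorem5 em O K ι cdvr isFractions d@(suc (suc (suc (suc n)))) d>4@(s≤s (s≤s (s≤s (s≤s _)))) first =
  finish-winning (preferential i₁ i₂) (λ f → winningMove _ ≡.refl f)
  where
  open Game K d
  open GameLemmas em K (IsFieldOfFractions.isField isFractions) d first
  open LastMove em O K ι cdvr isFractions d d>4 first

  i₁ i₂ : Fin (suc d)
  i₁ = suc zero
  -- The index `3 + n`, that is `d - 1`.
  i₂ = fromℕ< (s≤s (ℕₚ.n≤1+n (3 ℕ.+ n)))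

  last : Player
  last = lastMover first d

  σ : Strategy first last
  σ = finish (preferential i₁ i₂)

  -- By parity the last mover also moves after `d - 4` and after `d - 2` moves. The earlier round
  -- secures `i₁` and the later one `i₂`.
  innerChosen : ∀ {pos} {h : Play d pos} → Follows first last σ h →
                Chosen i₁ pos × Chosen i₂ pos
  innerChosen f
    with twoPlies i₁ i₂ (≡.sym (opponent-involutive _)) (ℕₚ.n≤1+n (3 ℕ.+ n)) f
  ... | _ , _ , f₀ , c₁ , c₁⇒c₂
    with twoPlies i₁ i₂ (≡.sym (≡.trans (opponent-involutive _) (opponent-involutive _)))
           (ℕₚ.m≤n+m (suc n) 3) f₀
  ...   | _ , _ , _ , c₁₀ , _ = c₁ , c₁⇒c₂ c₁₀

  inner : ∀ {pos} {h : Play d pos} → Follows first last σ h →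
          ∀ i → lookup pos i ≡ nothing → toℕ i ≢ 1 × d ℕ.∸ toℕ i ≢ 1
  inner {pos} f i eq with innerChosen f
  ... | c₁ , c₂ =
    (λ i≡1 → ≢chosen c₁ (Finₚ.toℕ-injective i≡1)) ,
    (λ d-i≡1 → ≢chosen c₂ (Finₚ.toℕ-injective
      (≡.trans (i≡d-1 d-i≡1) (≡.sym (Finₚ.toℕ-fromℕ< (s≤s (ℕₚ.n≤1+n (3 ℕ.+ n))))))))
    where
    ≢chosen : ∀ {j} → Chosen j pos → i ≢ j
    ≢chosen c ≡.refl = c eq

    i≡d-1 : d ℕ.∸ toℕ i ≡ 1 → toℕ i ≡ 3 ℕ.+ n
    i≡d-1 d-i≡1 = ≡.trans (≡.sym (ℕₚ.m∸[m∸n]≡n (Finₚ.toℕ≤pred[n] i)))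
                          (≡.cong (d ℕ.∸_) d-i≡1)

  -- The player is a variable tied to `last` by an equation, so that it can be matched on.
  winningMove : ∀ {pos} {h : Play d pos} P → last ≡ P → Follows first last σ h →
                WinningMove pos
  winningMove {pos} {h} wanda last≡wanda f = let m , wins = wandaWins h in
    m , ≡.subst (λ P → Wins P (makeMove pos m)) (≡.sym last≡wanda) wins
  winningMove {pos} {h} nora  last≡nora  f = let m , wins = noraWins h (inner f) in
    m , ≡.subst (λ P → Wins P (makeMove pos m)) (≡.sym last≡nora) wins
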